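{- Let $G$ be a finite graph with a self-loop on every vertex, and let $v$ be a vertex of $G$ of degree $d=d(v)$, where the self-loop at $v$ is counted once (so $d-1$ is the number of neighbours of $v$ other than $v$ itself). Then $$R(G,v)=\frac{C(G)}{C(G-\{v\})} \leq 1 + \frac{d^2-d}{2}.$$
   Context: For a finite graph $H$ (undirected, with a self-loop on every vertex and no multiple edges), $C(H)$ denotes the number of vertex-disjoint directed cycle covers of $H$, where cycles of every positive length are allowed: a cycle of length 1 is a single vertex using its loop, and a cycle of length 2 consists of two adjacent vertices using the edge between them in both directions. Equivalently, $C(H)$ is the number of permutations $\sigma$ of the vertex set of $H$ such that for every vertex $u$, either $\sigma(u)=u$ or $\sigma(u)$ is adjacent to $u$. The empty graph has $C=1$. $G-\{v\}$ denotes the graph obtained from $G$ by deleting $v$ and its incident edges, and $R(G,v)=C(G)/C(G-\{v\})$. -}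

module Defs where

open import Data.Nat.Base using (ℕ; zero; suc; NonZero; >-nonZero)
open import Data.Integer.Base using (+_)
open import Data.Rational.Base using (ℚ; _/_)
open import Data.Fin.Base using (Fin; zero; suc; punchIn)
open import Data.Fin.Properties using (all?; punchIn-injective)
open import Data.Fin.Permutation
  using (Permutation′; _⟨$⟩ʳ_; _≈_; id; insert; remove; insert-punchIn; insert-remove)
open import Data.List.Base using (List; []; _∷_; map; concatMap; filter; length; allFin)
open import Data.List.Properties using (filter-some)
open import Data.List.Membership.Propositional.Properties using (∈-allFin)
open import Data.List.Relation.Unary.All as All using (All)
open import Data.List.Relation.Unary.All.Properties as All using ()
open import Data.List.Relation.Unary.Any as Any using (Any; here)
open import Data.List.Relation.Unary.Any.Properties as Any using ()
open import Data.List.Relation.Unary.AllPairs as AllPairs using (AllPairs; []; _∷_)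
open import Data.List.Relation.Unary.AllPairs.Properties as AllPairs using ()
open import Data.List.Relation.Unary.Unique.Propositional.Properties using (allFin⁺)
open import Level using (0ℓ)
open import Relation.Binary.Core using (Rel)
open import Relation.Binary.Definitions using (Reflexive; Symmetric; Decidable)
open import Relation.Binary.PropositionalEquality
  using (_≡_; refl; sym; trans; cong; subst)
open import Relation.Nullary using (¬_; Dec)

private variable
  n : ℕ

-- Reflexivity is the self-loop on every vertex.  Decidability makes the
-- graph a finite object, so that degrees and cycle covers can be counted.
record Graph (n : ℕ) : Set₁ where
  field
    Edge      : Rel (Fin n) 0ℓ
    edge?     : Decidable Edge
    loop      : Reflexive Edge
    symmetric : Symmetric Edge

open Graph

-- The self-loop at v contributes exactly 1.
degree : Graph n → Fin n → ℕ
degree {n} G v = length (filter (edge? G v) (allFin n))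

infixl 6 _─_

_─_ : Graph (suc n) → Fin (suc n) → Graph n
Edge      (G ─ v) i j = Edge G (punchIn v i) (punchIn v j)
edge?     (G ─ v) i j = edge? G (punchIn v i) (punchIn v j)
loop      (G ─ v)     = loop G
symmetric (G ─ v)     = symmetric G

-- A vertex-disjoint directed cycle cover, given by its successor map σ.
-- The case σ u ≡ u (a cycle of length 1) uses the loop at u.
IsCycleCover : Graph n → Permutation′ n → Set
IsCycleCover G σ = ∀ u → Edge G u (σ ⟨$⟩ʳ u)

isCycleCover? : (G : Graph n) (σ : Permutation′ n) → Dec (IsCycleCover G σ)
isCycleCover? G σ = all? (λ u → edge? G u (σ ⟨$⟩ʳ u))

-- Every permutation of Fin n exactly once up to pointwise equality _≈_
-- (permutations-complete, permutations-unique): choose the image j of zero,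
-- then a permutation of the rest.
permutations : ∀ n → List (Permutation′ n)
permutations zero    = id ∷ []
permutations (suc n) =
  concatMap (λ j → map (insert zero j) (permutations n)) (allFin (suc n))

C : Graph n → ℕ
C {n} G = length (filter (isCycleCover? G) (permutations n))

insert-cong : ∀ j {π ρ : Permutation′ n} → π ≈ ρ →
              insert zero j π ≈ insert zero j ρ
insert-cong j         π≈ρ zero    = refl
insert-cong j {π} {ρ} π≈ρ (suc k) =
  trans (insert-punchIn zero j π k)
    (trans (cong (punchIn j) (π≈ρ k)) (sym (insert-punchIn zero j ρ k)))

insert-injective : ∀ j {π ρ : Permutation′ n} →
                   insert zero j π ≈ insert zero j ρ → π ≈ ρ
insert-injective j {π} {ρ} eq k = punchIn-injective j _ _
  (trans (sym (insert-punchIn zero j π k))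
    (trans (eq (suc k)) (insert-punchIn zero j ρ k)))

permutations-complete : (π : Permutation′ n) → Any (π ≈_) (permutations n)
permutations-complete {zero}  π = here λ ()
permutations-complete {suc n} π =
  Any.concatMap⁺ (λ j → map (insert zero j) (permutations n))
    (Any.map block (∈-allFin (π ⟨$⟩ʳ zero)))
  where
  block : ∀ {j} → π ⟨$⟩ʳ zero ≡ j →
          Any (π ≈_) (map (insert zero j) (permutations n))
  block refl = Any.map⁺ (Any.map
    (λ {ρ} eq k → trans (sym (insert-remove zero π k)) (insert-cong _ {remove zero π} {ρ} eq k))
    (permutations-complete (remove zero π)))

permutations-unique : ∀ n → AllPairs (λ π ρ → ¬ π ≈ ρ) (permutations n)
permutations-unique zero    = All.[] ∷ []
permutations-unique (suc n) = AllPairs.concat⁺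
  (All.map⁺ (All.universal
    (λ j → AllPairs.map⁺ (AllPairs.map
      (λ {π} {ρ} π≉ρ eq → π≉ρ (insert-injective j {π} {ρ} eq))
      (permutations-unique n)))
    (allFin (suc n))))
  (AllPairs.map⁺ (AllPairs.map
    (λ i≢j → All.map⁺ (All.universal
      (λ _ → All.map⁺ (All.universal (λ _ eq → i≢j (eq zero)) _)) _))
    (allFin⁺ (suc n))))

-- The identity is a cycle cover, because every vertex has a loop.
C-nonZero : (G : Graph n) → NonZero (C G)
C-nonZero G = >-nonZero (filter-some (isCycleCover? G)
  (Any.map (λ id≈π u → subst (Edge G u) (id≈π u) (loop G)) (permutations-complete id)))

R : Graph (suc n) → Fin (suc n) → ℚ
R G v = (+ C G / C (G ─ v)) {{C-nonZero (G ─ v)}}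

{-# OPTIONS --safe #-}

-- C(G) is the permanent of the adjacency matrix A of G.  Write [R|S] for the
-- permanent of the submatrix with rows R and columns S, and W for the vertices
-- other than v.  Expanding [vW|vW] along row v and column v leaves [W|W] and a
-- term for each ordered pair (s, r) of neighbours of v.  For s = r it is at most
-- [W|W] because of the loop at s.  For s ≠ r it is [sU|rU] with W = srU, and
-- 2 [sU|rU] ≤ [srU|srU].  To see this, let z, p, q, t count the covers of srU
-- that fix both s and r, only s, only r, or neither.  Superposing two covers
-- gives [sU|rU] [rU|sU] ≤ t z + q p, so 4 [sU|rU]² ≤ 4 (z + p) (q + t) ≤
-- (z + p + q + t)².  Hence with k = d − 1 neighbours the terms add up to at most
-- (1 + k + k (k − 1) / 2) [W|W].  The superposition inequality holds for all
-- nonnegative matrices and follows from Laplace expansion by induction.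
module Submission where

open import Defs
open import Data.Bool.Base using (true; false; if_then_else_)
open import Data.Fin.Base using (Fin; zero; suc; punchIn)
open import Data.Fin.Permutation using (Permutation′; _⟨$⟩ʳ_; insert; insert-punchIn)
open import Data.Fin.Properties using (all?)
open import Data.List.Base
  using (List; []; _∷_; _++_; map; length; filter; concatMap; tabulate; allFin)
open import Data.List.Properties
  using (length-++; filter-++; filter-≐; filter-none; map-∘; map-id; map-tabulate; tabulate-cong)
open import Data.List.Relation.Binary.Permutation.Propositional
  using (_↭_; refl; prep; swap; trans; ↭-refl)
open import Data.List.Relation.Binary.Permutation.Propositional.Properties
  using (All-resp-↭; ↭-length)
open import Data.List.Relation.Unary.All as All using (All; []; _∷_)
import Data.List.Relation.Unary.All.Properties as All
open import Data.Nat.Base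
  using (ℕ; zero; suc; _+_; _*_; _≤_; z≤n; NonZero)
open import Data.Nat.ListAction using (sum)
open import Data.Nat.Properties
open import Data.Nat.Tactic.RingSolver using (solve-∀)
open import Data.Product.Base using (_,_)
open import Data.Sum.Base using (inj₁; inj₂)
open import Function.Base using (flip; id; _∘_)
open import Function.Bundles using (mk⇔)
open import Relation.Binary.Definitions using (Decidable)
open import Relation.Binary.PropositionalEquality as ≡
  using (_≡_; _≢_; refl; cong; cong₂; sym; subst; module ≡-Reasoning)
open import Relation.Nullary using (Dec; yes; no; does; contradiction)
open import Relation.Nullary.Decidable using (does-⇔; dec-true)
import Relation.Unary as Unary

private variable
  X Y V X′ Y′ : Set
  xs ys : List X
  n : ℕ

-- Sums over the choice of one list entry.

-- ∑ xs f sums f x zs over the ways of picking an entry x of xs, where zs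
-- lists the remaining entries.
∑ : List X → (X → List X → ℕ) → ℕ
∑ []       f = 0
∑ (x ∷ xs) f = f x xs + ∑ xs (λ y ys → f y (x ∷ ys))

-- The permutation handed to the hypothesis says that the picked entry and the remaining ones
-- reassemble `xs`. Inside an expansion it relates a minor to the full matrix.
∑-cong : ∀ (xs : List X) {f g : X → List X → ℕ} →
         (∀ y ys → xs ↭ y ∷ ys → f y ys ≡ g y ys) → ∑ xs f ≡ ∑ xs g
∑-cong []       f≡g = refl
∑-cong (x ∷ xs) f≡g = cong₂ _+_ (f≡g x xs ↭-refl)
  (∑-cong xs λ y ys p → f≡g y (x ∷ ys) (trans (prep x p) (swap x y ↭-refl)))

∑-mono : ∀ (xs : List X) {f g : X → List X → ℕ} →
         (∀ y ys → xs ↭ y ∷ ys → f y ys ≤ g y ys) → ∑ xs f ≤ ∑ xs g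
∑-mono []       f≤g = z≤n
∑-mono (x ∷ xs) f≤g = +-mono-≤ (f≤g x xs ↭-refl)
  (∑-mono xs λ y ys p → f≤g y (x ∷ ys) (trans (prep x p) (swap x y ↭-refl)))

∑-zero : ∀ (xs : List X) → ∑ xs (λ _ _ → 0) ≡ 0
∑-zero []       = refl
∑-zero (x ∷ xs) = ∑-zero xs

∑-+ : ∀ (xs : List X) (f g : X → List X → ℕ) →
      ∑ xs (λ y ys → f y ys + g y ys) ≡ ∑ xs f + ∑ xs g
∑-+ []       f g = refl
∑-+ (x ∷ xs) f g = ≡.trans
  (cong (f x xs + g x xs +_) (∑-+ xs (λ y ys → f y (x ∷ ys)) (λ y ys → g y (x ∷ ys))))
  (lemma (f x xs) (g x xs) _ _)
  where
  lemma : ∀ a b c d → a + b + (c + d) ≡ a + c + (b + d)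
  lemma = solve-∀

∑-*ʳ : ∀ (xs : List X) (f : X → List X → ℕ) k →
       ∑ xs f * k ≡ ∑ xs (λ y ys → f y ys * k)
∑-*ʳ []       f k = refl
∑-*ʳ (x ∷ xs) f k = ≡.trans (*-distribʳ-+ k (f x xs) _)
  (cong (f x xs * k +_) (∑-*ʳ xs (λ y ys → f y (x ∷ ys)) k))

∑-*ˡ : ∀ (xs : List X) (f : X → List X → ℕ) k →
       k * ∑ xs f ≡ ∑ xs (λ y ys → k * f y ys)
∑-*ˡ xs f k = ≡.trans (*-comm k (∑ xs f))
  (≡.trans (∑-*ʳ xs f k) (∑-cong xs λ y ys _ → *-comm (f y ys) k))

∑-comm : ∀ (xs : List X) (ys : List Y) (f : X → List X → Y → List Y → ℕ) →
         ∑ xs (λ x xs′ → ∑ ys (f x xs′)) ≡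
         ∑ ys (λ y ys′ → ∑ xs (λ x xs′ → f x xs′ y ys′))
∑-comm []       ys f = sym (∑-zero ys)
∑-comm (x ∷ xs) ys f = ≡.trans
  (cong (∑ ys (f x xs) +_) (∑-comm xs ys (λ y ys′ → f y (x ∷ ys′))))
  (sym (∑-+ ys (f x xs) _))

∑-map : ∀ (h : X → Y) xs (f : Y → List Y → ℕ) →
        ∑ (map h xs) f ≡ ∑ xs (λ y ys → f (h y) (map h ys))
∑-map h []       f = refl
∑-map h (x ∷ xs) f = cong (f (h x) (map h xs) +_) (∑-map h xs (λ y ys → f y (h x ∷ ys)))

-- Reordering the list also reorders the entries that remain after a pick, so `f` has to ignore
-- their order.
∑-↭ : {f : X → List X → ℕ} → (∀ x {zs zs′} → zs ↭ zs′ → f x zs ≡ f x zs′) →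
      xs ↭ ys → ∑ xs f ≡ ∑ ys f
∑-↭ resp refl = refl
∑-↭ {f = f} resp (prep x p) =
  cong₂ _+_ (resp x p) (∑-↭ (λ y q → resp y (prep x q)) p)
∑-↭ {f = f} resp (swap {xs = xs} {ys = ys} x y p) = begin
  f x (y ∷ xs) + (f y (x ∷ xs) + ∑ xs (λ z zs → f z (x ∷ y ∷ zs)))
    ≡⟨ lemma (f x (y ∷ xs)) (f y (x ∷ xs)) _ ⟩
  f y (x ∷ xs) + (f x (y ∷ xs) + ∑ xs (λ z zs → f z (x ∷ y ∷ zs)))
    ≡⟨ cong₂ _+_ (resp y (prep x p)) (cong₂ _+_ (resp x (prep y p))
        (≡.trans (∑-cong xs λ z zs _ → resp z (swap x y ↭-refl))
                 (∑-↭ (λ z q → resp z (prep y (prep x q))) p))) ⟩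
  f y (x ∷ ys) + (f x (y ∷ ys) + ∑ ys (λ z zs → f z (y ∷ x ∷ zs))) ∎
  where
  open ≡-Reasoning
  lemma : ∀ a b c → a + (b + c) ≡ b + (a + c)
  lemma = solve-∀
∑-↭ resp (trans p q) = ≡.trans (∑-↭ resp p) (∑-↭ resp q)

-- Permanents of submatrices and their Laplace expansions.

-- The permanent is 0 unless xs and ys have the same length.
per : (X → Y → ℕ) → List X → List Y → ℕ
per A []       []       = 1
per A []       (_ ∷ _)  = 0
per A (x ∷ xs) ys       = ∑ ys (λ y ys′ → A x y * per A xs ys′)

-- Column `y` is matched with the head row, which gives the first summand, or with a later row. In
-- the second case, expanding along row `x` first or along column `y` first gives the same double
-- sum.
per-expandᶜ : ∀ (A : X → Y → ℕ) xs y ys →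
              per A xs (y ∷ ys) ≡ ∑ xs (λ x xs′ → A x y * per A xs′ ys)
per-expandᶜ A []       y ys = refl
per-expandᶜ A (x ∷ xs) y ys = cong (A x y * per A xs ys +_) (begin
  ∑ ys (λ z zs → A x z * per A xs (y ∷ zs))
    ≡⟨ ∑-cong ys (λ z zs _ → ≡.trans (cong (A x z *_) (per-expandᶜ A xs y zs))
                                     (∑-*ˡ xs _ (A x z))) ⟩
  ∑ ys (λ z zs → ∑ xs (λ w ws → A x z * (A w y * per A ws zs)))
    ≡⟨ ∑-comm ys xs _ ⟩
  ∑ xs (λ w ws → ∑ ys (λ z zs → A x z * (A w y * per A ws zs)))
    ≡⟨ ∑-cong xs (λ w ws _ → ≡.trans
        (∑-cong ys λ z zs _ → lemma (A x z) (A w y) _)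
        (sym (∑-*ˡ ys _ (A w y)))) ⟩
  ∑ xs (λ w ws → A w y * ∑ ys (λ z zs → A x z * per A ws zs)) ∎)
  where
  open ≡-Reasoning
  lemma : ∀ a b c → a * (b * c) ≡ b * (a * c)
  lemma = solve-∀

per-transpose : ∀ (A : X → Y → ℕ) xs ys → per A xs ys ≡ per (flip A) ys xs
per-transpose A []       []       = refl
per-transpose A (x ∷ xs) []       = refl
per-transpose A xs       (y ∷ ys) = ≡.trans (per-expandᶜ A xs y ys)
  (∑-cong xs λ x xs′ _ → cong (A x y *_) (per-transpose A xs′ ys))

per-↭ᶜ : ∀ (A : X → Y → ℕ) xs {ys ys′} → ys ↭ ys′ → per A xs ys ≡ per A xs ys′
per-↭ᶜ A []       refl         = refl
per-↭ᶜ A []       (prep _ _)   = refl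
per-↭ᶜ A []       (swap _ _ _) = refl
per-↭ᶜ A []       (trans p q)  = ≡.trans (per-↭ᶜ A [] p) (per-↭ᶜ A [] q)
per-↭ᶜ A (x ∷ xs) p = ∑-↭ (λ y q → cong (A x y *_) (per-↭ᶜ A xs q)) p

per-↭ʳ : ∀ (A : X → Y → ℕ) ys {xs xs′} → xs ↭ xs′ → per A xs ys ≡ per A xs′ ys
per-↭ʳ A ys {xs} {xs′} p = ≡.trans (per-transpose A xs ys)
  (≡.trans (per-↭ᶜ (flip A) ys p) (sym (per-transpose A xs′ ys)))

per-↭ : ∀ (A : X → Y → ℕ) {xs xs′ ys ys′} → xs ↭ xs′ → ys ↭ ys′ →
        per A xs ys ≡ per A xs′ ys′
per-↭ A {xs′ = xs′} {ys = ys} p q = ≡.trans (per-↭ʳ A ys p) (per-↭ᶜ A xs′ q)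

per-mono : ∀ (A B : X → Y → ℕ) → (∀ x y → A x y ≤ B x y) →
           ∀ xs ys → per A xs ys ≤ per B xs ys
per-mono A B A≤B []       []       = ≤-refl
per-mono A B A≤B []       (_ ∷ _)  = ≤-refl
per-mono A B A≤B (x ∷ xs) ys       =
  ∑-mono ys λ y ys′ _ → *-mono-≤ (A≤B x y) (per-mono A B A≤B xs ys′)

per-cong : ∀ (A B : X → Y → ℕ) → (∀ x y → A x y ≡ B x y) →
           ∀ xs ys → per A xs ys ≡ per B xs ys
per-cong A B A≡B xs ys = ≤-antisym
  (per-mono A B (λ x y → ≤-reflexive (A≡B x y)) xs ys)
  (per-mono B A (λ x y → ≤-reflexive (sym (A≡B x y))) xs ys)

-- Only entries in a listed row and a listed column enter a permanent, so the matrices may differ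
-- outside that block.
per-cong-All : ∀ (A B : X → Y → ℕ) {P : X → Set} {Q : Y → Set} →
               (∀ {x y} → P x → Q y → A x y ≡ B x y) →
               All P xs → All Q ys → per A xs ys ≡ per B xs ys
per-cong-All {ys = []}    A B A≡B []       qs = refl
per-cong-All {ys = _ ∷ _} A B A≡B []       qs = refl
per-cong-All {ys = ys}    A B A≡B (p ∷ ps) qs = ∑-cong ys λ y ys′ ys↭ →
  let qs′ = All-resp-↭ ys↭ qs in
  cong₂ _*_ (A≡B p (All.head qs′)) (per-cong-All A B A≡B ps (All.tail qs′))

per-map : ∀ (A : X′ → Y′ → ℕ) (f : X → X′) (g : Y → Y′) xs ys →
          per A (map f xs) (map g ys) ≡ per (λ x y → A (f x) (g y)) xs ys
per-map A f g []       []      = refl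
per-map A f g []       (_ ∷ _) = refl
per-map A f g (x ∷ xs) ys      = ≡.trans (∑-map g ys _)
  (∑-cong ys λ y ys′ _ → cong (A (f x) (g y) *_) (per-map A f g xs ys′))

-- The exchange inequality for permanents.

module _ (A : X → Y → ℕ) where

  private
    ⟨_∣_⟩ : List X → List Y → ℕ
    ⟨ R ∣ S ⟩ = per A R S

  -- Expand row y, then column s, where s is the column matched with y: what
  -- remains is the exchange inequality for a smaller matrix, with y replaced by
  -- the row r matched with s.
  exchange : ∀ n R S x y u v → length R ≡ n →
    ⟨ x ∷ R ∣ u ∷ S ⟩ * ⟨ y ∷ R ∣ v ∷ S ⟩ ≤
    ⟨ x ∷ y ∷ R ∣ u ∷ v ∷ S ⟩ * ⟨ R ∣ S ⟩ + ⟨ x ∷ R ∣ v ∷ S ⟩ * ⟨ y ∷ R ∣ u ∷ S ⟩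

  -- A permanental form, with ≤, of a three-term Plücker relation. Column `s` of the first factor is
  -- matched with `x` or with some `r` in `R`. The term for `x` also occurs in the last product on
  -- the right; the term for `r` is an instance of `exchange` with `r` taken out of `R`.
  exchange-half : ∀ n R T s x u v → length R ≡ n →
    ⟨ x ∷ R ∣ s ∷ u ∷ T ⟩ * ⟨ R ∣ v ∷ T ⟩ ≤
    ⟨ x ∷ R ∣ u ∷ v ∷ T ⟩ * ⟨ R ∣ s ∷ T ⟩ + ⟨ x ∷ R ∣ s ∷ v ∷ T ⟩ * ⟨ R ∣ u ∷ T ⟩

  exchange-half n R T s x u v eq = begin
    ⟨ x ∷ R ∣ s ∷ u ∷ T ⟩ * p
      ≡⟨ cong (_* p) (per-expandᶜ A (x ∷ R) s (u ∷ T)) ⟩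
    (A x s * q + ∑ R f) * p
      ≡⟨ lemma₁ (A x s) q (∑ R f) p ⟩
    A x s * p * q + ∑ R f * p
      ≤⟨ +-monoʳ-≤ (A x s * p * q) (begin
        ∑ R f * p
          ≡⟨ ∑-*ʳ R f p ⟩
        ∑ R (λ r Q → f r Q * p)
          ≤⟨ ∑-mono R (step n eq) ⟩
        ∑ R (λ r Q → P * g r Q + h r Q * q)
          ≡⟨ ∑-+ R _ _ ⟩
        ∑ R (λ r Q → P * g r Q) + ∑ R (λ r Q → h r Q * q)
          ≡⟨ cong₂ _+_ (∑-*ˡ R g P) (∑-*ʳ R h q) ⟨
        P * ∑ R g + ∑ R h * q ∎) ⟩
    A x s * p * q + (P * ∑ R g + ∑ R h * q)
      ≡⟨ lemma₂ (A x s) p q P (∑ R g) (∑ R h) ⟩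
    P * ∑ R g + (A x s * p + ∑ R h) * q
      ≡⟨ cong₂ (λ a b → P * a + b * q)
          (per-expandᶜ A R s T) (per-expandᶜ A (x ∷ R) s (v ∷ T)) ⟨
    P * ⟨ R ∣ s ∷ T ⟩ + ⟨ x ∷ R ∣ s ∷ v ∷ T ⟩ * q ∎
    where
    open ≤-Reasoning
    p q P : ℕ
    p = ⟨ R ∣ v ∷ T ⟩
    q = ⟨ R ∣ u ∷ T ⟩
    P = ⟨ x ∷ R ∣ u ∷ v ∷ T ⟩
    f g h : X → List X → ℕ
    f r Q = A r s * ⟨ x ∷ Q ∣ u ∷ T ⟩
    g r Q = A r s * ⟨ Q ∣ T ⟩
    h r Q = A r s * ⟨ x ∷ Q ∣ v ∷ T ⟩
    lemma₁ : ∀ a q f p → (a * q + f) * p ≡ a * p * q + f * p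
    lemma₁ = solve-∀
    lemma₂ : ∀ a p q P g h → a * p * q + (P * g + h * q) ≡ P * g + (a * p + h) * q
    lemma₂ = solve-∀
    lemma₃ : ∀ a b c d e → a * (b * c + d * e) ≡ b * (a * c) + a * d * e
    lemma₃ = solve-∀
    -- The mutual recursion descends on the length of `R`, which loses the row `r` here; an empty
    -- `R` offers no row to pick.
    step : ∀ n → length R ≡ n → ∀ r Q → R ↭ r ∷ Q → f r Q * p ≤ P * g r Q + h r Q * q
    step zero    eq r Q perm with () ← ≡.trans (sym eq) (↭-length perm)
    step (suc n) eq r Q perm = begin
      f r Q * p
        ≡⟨ cong (f r Q *_) (per-↭ʳ A (v ∷ T) perm) ⟩
      A r s * ⟨ x ∷ Q ∣ u ∷ T ⟩ * ⟨ r ∷ Q ∣ v ∷ T ⟩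
        ≡⟨ *-assoc (A r s) _ _ ⟩
      A r s * (⟨ x ∷ Q ∣ u ∷ T ⟩ * ⟨ r ∷ Q ∣ v ∷ T ⟩)
        ≤⟨ *-monoʳ-≤ (A r s) (exchange n Q T x r u v
            (suc-injective (≡.trans (sym (↭-length perm)) eq))) ⟩
      A r s * (⟨ x ∷ r ∷ Q ∣ u ∷ v ∷ T ⟩ * ⟨ Q ∣ T ⟩ +
               ⟨ x ∷ Q ∣ v ∷ T ⟩ * ⟨ r ∷ Q ∣ u ∷ T ⟩)
        ≡⟨ cong₂ (λ a b → A r s * (a * ⟨ Q ∣ T ⟩ + ⟨ x ∷ Q ∣ v ∷ T ⟩ * b))
            (per-↭ʳ A (u ∷ v ∷ T) (prep x perm)) (per-↭ʳ A (u ∷ T) perm) ⟨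
      A r s * (P * ⟨ Q ∣ T ⟩ + ⟨ x ∷ Q ∣ v ∷ T ⟩ * q)
        ≡⟨ lemma₃ (A r s) P _ _ q ⟩
      P * g r Q + h r Q * q ∎

  exchange n R S x y u v eq = begin
    p * (A y v * c + ∑ S f)
      ≡⟨ lemma₁ p (A y v) c (∑ S f) ⟩
    A y v * p * c + p * ∑ S f
      ≤⟨ +-monoʳ-≤ (A y v * p * c) (begin
        p * ∑ S f
          ≡⟨ ∑-*ˡ S f p ⟩
        ∑ S (λ s T → p * f s T)
          ≤⟨ ∑-mono S step ⟩
        ∑ S (λ s T → g s T * c + q * h s T)
          ≡⟨ ∑-+ S _ _ ⟩
        ∑ S (λ s T → g s T * c) + ∑ S (λ s T → q * h s T)
          ≡⟨ cong₂ _+_ (∑-*ʳ S g c) (∑-*ˡ S h q) ⟨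
        ∑ S g * c + q * ∑ S h ∎) ⟩
    A y v * p * c + (∑ S g * c + q * ∑ S h)
      ≡⟨ lemma₂ (A y v) p c (∑ S g) q (∑ S h) ⟩
    (A y v * p + ∑ S g) * c + q * ∑ S h
      -- The terms in which row `y` takes column `u` are dropped. This is the only loss in the
      -- induction; for determinants these two terms would cancel.
      ≤⟨ +-mono-≤ (*-monoˡ-≤ c (m≤n+m (A y v * p + ∑ S g) (A y u * ⟨ x ∷ R ∣ v ∷ S ⟩)))
                  (*-monoʳ-≤ q (m≤n+m (∑ S h) (A y u * c))) ⟩
    ⟨ y ∷ x ∷ R ∣ u ∷ v ∷ S ⟩ * c + q * ⟨ y ∷ R ∣ u ∷ S ⟩
      ≡⟨ cong (λ a → a * c + q * ⟨ y ∷ R ∣ u ∷ S ⟩)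
          (per-↭ʳ A (u ∷ v ∷ S) (swap {xs = R} y x ↭-refl)) ⟩
    ⟨ x ∷ y ∷ R ∣ u ∷ v ∷ S ⟩ * c + q * ⟨ y ∷ R ∣ u ∷ S ⟩ ∎
    where
    open ≤-Reasoning
    p q c : ℕ
    p = ⟨ x ∷ R ∣ u ∷ S ⟩
    q = ⟨ x ∷ R ∣ v ∷ S ⟩
    c = ⟨ R ∣ S ⟩
    f g h : Y → List Y → ℕ
    f s T = A y s * ⟨ R ∣ v ∷ T ⟩
    g s T = A y s * ⟨ x ∷ R ∣ u ∷ v ∷ T ⟩
    h s T = A y s * ⟨ R ∣ u ∷ T ⟩
    lemma₁ : ∀ p a c f → p * (a * c + f) ≡ a * p * c + p * f
    lemma₁ = solve-∀
    lemma₂ : ∀ a p c g q h → a * p * c + (g * c + q * h) ≡ (a * p + g) * c + q * h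
    lemma₂ = solve-∀
    lemma₃ : ∀ p a b → p * (a * b) ≡ a * (p * b)
    lemma₃ = solve-∀
    lemma₄ : ∀ a b c d e → a * (b * c + d * e) ≡ a * b * c + d * (a * e)
    lemma₄ = solve-∀
    step : ∀ s T → S ↭ s ∷ T → p * f s T ≤ g s T * c + q * h s T
    step s T perm = begin
      p * (A y s * ⟨ R ∣ v ∷ T ⟩)
        ≡⟨ lemma₃ p (A y s) ⟨ R ∣ v ∷ T ⟩ ⟩
      A y s * (p * ⟨ R ∣ v ∷ T ⟩)
        ≡⟨ cong (λ a → A y s * (a * ⟨ R ∣ v ∷ T ⟩))
            (per-↭ᶜ A (x ∷ R) (trans (prep u perm) (swap u s ↭-refl))) ⟩
      A y s * (⟨ x ∷ R ∣ s ∷ u ∷ T ⟩ * ⟨ R ∣ v ∷ T ⟩)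
        ≤⟨ *-monoʳ-≤ (A y s) (exchange-half n R T s x u v eq) ⟩
      A y s * (⟨ x ∷ R ∣ u ∷ v ∷ T ⟩ * ⟨ R ∣ s ∷ T ⟩ +
               ⟨ x ∷ R ∣ s ∷ v ∷ T ⟩ * ⟨ R ∣ u ∷ T ⟩)
        ≡⟨ cong₂ (λ a b → A y s * (⟨ x ∷ R ∣ u ∷ v ∷ T ⟩ * a + b * ⟨ R ∣ u ∷ T ⟩))
            (per-↭ᶜ A R perm)
            (per-↭ᶜ A (x ∷ R) (trans (prep v perm) (swap v s ↭-refl))) ⟨
      A y s * (⟨ x ∷ R ∣ u ∷ v ∷ T ⟩ * c + q * ⟨ R ∣ u ∷ T ⟩)
        ≡⟨ lemma₄ (A y s) _ c q _ ⟩
      g s T * c + q * h s T ∎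

-- Twice an off-diagonal minor is at most the full permanent.

m≤n⇒4mn≤[m+n]² : ∀ {m n} → m ≤ n → 4 * (m * n) ≤ (m + n) * (m + n)
m≤n⇒4mn≤[m+n]² {m} m≤n with k , refl ← m≤n⇒∃[o]m+o≡n m≤n =
  -- With n = m + k the two sides differ by k².
  ≤-trans (m≤m+n _ (k * k)) (≤-reflexive (lemma m k))
  where
  lemma : ∀ m k → 4 * (m * (m + k)) + k * k ≡ (m + (m + k)) * (m + (m + k))
  lemma = solve-∀

4mn≤[m+n]² : ∀ m n → 4 * (m * n) ≤ (m + n) * (m + n)
4mn≤[m+n]² m n with ≤-total m n
... | inj₁ m≤n = m≤n⇒4mn≤[m+n]² m≤n
... | inj₂ n≤m = begin
  4 * (m * n)       ≡⟨ cong (4 *_) (*-comm m n) ⟩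
  4 * (n * m)       ≤⟨ m≤n⇒4mn≤[m+n]² n≤m ⟩
  (n + m) * (n + m) ≡⟨ cong₂ _*_ (+-comm n m) (+-comm n m) ⟩
  (m + n) * (m + n) ∎
  where open ≤-Reasoning

m²≤n²⇒m≤n : ∀ {m n} → m * m ≤ n * n → m ≤ n
m²≤n²⇒m≤n m²≤n² = ≮⇒≥ λ n<m → <⇒≱ (*-mono-< n<m n<m) m²≤n²

-- In the expansion along row `x`, the entry 1 of `B` at (x, y) contributes the first summand, while
-- the entry 0 of `A` removes that term; the other terms compare entrywise. This adds the covers
-- that fix a vertex to those that move it.
per-unfix : ∀ (A B : X → Y → ℕ) {x y} → (∀ x y → A x y ≤ B x y) →
            A x y ≡ 0 → B x y ≡ 1 → ∀ xs ys →
            per B xs ys + per A (x ∷ xs) (y ∷ ys) ≤ per B (x ∷ xs) (y ∷ ys)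
per-unfix A B {x} {y} A≤B Axy≡0 Bxy≡1 xs ys = begin
  per B xs ys + per A (x ∷ xs) (y ∷ ys)
    ≡⟨ cong (λ a → per B xs ys +
          (a * per A xs ys + ∑ ys (λ z zs → A x z * per A xs (y ∷ zs)))) Axy≡0 ⟩
  per B xs ys + ∑ ys (λ z zs → A x z * per A xs (y ∷ zs))
    ≤⟨ +-monoʳ-≤ (per B xs ys) (∑-mono ys λ z zs _ →
        *-mono-≤ (A≤B x z) (per-mono A B A≤B xs (y ∷ zs))) ⟩
  per B xs ys + S
    ≡⟨ cong (_+ S) (*-identityˡ (per B xs ys)) ⟨
  1 * per B xs ys + S
    ≡⟨ cong (λ a → a * per B xs ys + S) Bxy≡1 ⟨
  per B (x ∷ xs) (y ∷ ys) ∎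
  where
  open ≤-Reasoning
  S : ℕ
  S = ∑ ys (λ z zs → B x z * per B xs (y ∷ zs))

data Marked (V : Set) : Set where
  first second : Marked V
  rest         : V → Marked V

module _ (A : V → V → ℕ) (A-sym : ∀ x y → A x y ≡ A y x) (A-refl : ∀ x → A x x ≡ 1) where

  module _ (a b : V) where

    -- M α β is A with the diagonal entries at a and b replaced by α and β; the
    -- marks keep these entries apart from other occurrences of a and b in a list.
    private
      unmark : Marked V → V
      unmark first    = a
      unmark second   = b
      unmark (rest x) = x

      M : ℕ → ℕ → Marked V → Marked V → ℕ
      M α β first  first  = α
      M α β second second = β
      M α β x      y      = A (unmark x) (unmark y)

      M-sym : ∀ α β x y → M α β x y ≡ M α β y x
      M-sym α β first    first    = refl
      M-sym α β first    second   = A-sym a b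
      M-sym α β first    (rest y) = A-sym a y
      M-sym α β second   first    = A-sym b a
      M-sym α β second   second   = refl
      M-sym α β second   (rest y) = A-sym b y
      M-sym α β (rest x) first    = A-sym x a
      M-sym α β (rest x) second   = A-sym x b
      M-sym α β (rest x) (rest y) = A-sym x y

      M-mono : ∀ {α α′ β β′} → α ≤ α′ → β ≤ β′ → ∀ x y → M α β x y ≤ M α′ β′ x y
      M-mono α≤ β≤ first    first    = α≤
      M-mono α≤ β≤ first    second   = ≤-refl
      M-mono α≤ β≤ first    (rest _) = ≤-refl
      M-mono α≤ β≤ second   first    = ≤-refl
      M-mono α≤ β≤ second   second   = β≤
      M-mono α≤ β≤ second   (rest _) = ≤-refl
      M-mono α≤ β≤ (rest _) _        = ≤-refl

      -- Reaching an altered entry takes the column `first` or the row `second`, and both are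
      -- excluded.
      M-off : ∀ {α α′ β β′ x y} → x ≢ second → y ≢ first → M α β x y ≡ M α′ β′ x y
      M-off {x = first}  {first}  _  q = contradiction refl q
      M-off {x = first}  {second} _  _ = refl
      M-off {x = first}  {rest _} _  _ = refl
      M-off {x = second}          p  _ = contradiction refl p
      M-off {x = rest _}          _  _ = refl

      M₁₁ : ∀ x y → M 1 1 x y ≡ A (unmark x) (unmark y)
      M₁₁ first    first    = sym (A-refl a)
      M₁₁ first    second   = refl
      M₁₁ first    (rest _) = refl
      M₁₁ second   first    = refl
      M₁₁ second   second   = sym (A-refl b)
      M₁₁ second   (rest _) = refl
      M₁₁ (rest _) _        = refl

      per-M₁₁ : ∀ xs ys → per (M 1 1) xs ys ≡ per A (map unmark xs) (map unmark ys)
      per-M₁₁ xs ys = ≡.trans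
        (per-cong (M 1 1) (λ x y → A (unmark x) (unmark y)) M₁₁ xs ys)
        (sym (per-map A unmark unmark xs ys))

      unmark-rest : ∀ U → map unmark (map rest U) ≡ U
      unmark-rest U = ≡.trans (sym (map-∘ U)) (map-id U)

    2*offdiag≤per : ∀ U → 2 * per A (a ∷ U) (b ∷ U) ≤ per A (a ∷ b ∷ U) (a ∷ b ∷ U)
    2*offdiag≤per U = m²≤n²⇒m≤n (begin
      2 * P * (2 * P)
        ≡⟨ lemma₁ P ⟩
      4 * (P * P)
        ≤⟨ *-monoʳ-≤ 4 P²≤ ⟩
      4 * (t * z + q * p)
        -- The added products complete the sum to (z + p)(q + t).
        ≤⟨ *-monoʳ-≤ 4 (m≤m+n (t * z + q * p) (z * q + p * t)) ⟩
      4 * (t * z + q * p + (z * q + p * t))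
        ≡⟨ cong (4 *_) (lemma₂ z p q t) ⟩
      4 * ((z + p) * (q + t))
        ≤⟨ 4mn≤[m+n]² (z + p) (q + t) ⟩
      (z + p + (q + t)) * (z + p + (q + t))
        ≤⟨ *-mono-≤ ≤D ≤D ⟩
      D * D ∎)
      where
      open ≤-Reasoning
      U′ : List (Marked V)
      U′ = map rest U
      -- A marked vertex absent from the lists counts as fixed; a listed one has diagonal entry 0
      -- and must move.
      P D z p q t : ℕ
      P = per A (a ∷ U) (b ∷ U)
      D = per A (a ∷ b ∷ U) (a ∷ b ∷ U)
      z = per (M 0 0) U′ U′
      p = per (M 0 0) (second ∷ U′) (second ∷ U′)
      q = per (M 0 0) (first ∷ U′) (first ∷ U′)
      t = per (M 0 0) (first ∷ second ∷ U′) (first ∷ second ∷ U′)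

      lemma₁ : ∀ P → 2 * P * (2 * P) ≡ 4 * (P * P)
      lemma₁ = solve-∀
      lemma₂ : ∀ z p q t → t * z + q * p + (z * q + p * t) ≡ (z + p) * (q + t)
      lemma₂ = solve-∀

      P₁₂ : P ≡ per (M 0 0) (first ∷ U′) (second ∷ U′)
      P₁₂ = ≡.trans
        (cong (λ W → per A (a ∷ W) (b ∷ W)) (sym (unmark-rest U)))
        (≡.trans (sym (per-M₁₁ (first ∷ U′) (second ∷ U′)))
          (per-cong-All {xs = first ∷ U′} {ys = second ∷ U′} (M 1 1) (M 0 0)
            {_≢ second} {_≢ first} M-off
            ((λ ()) ∷ All.map⁺ (All.universal (λ _ ()) U))
            ((λ ()) ∷ All.map⁺ (All.universal (λ _ ()) U))))

      -- Transposing the symmetric matrix interchanges the two marks, so the product on the left of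
      -- `exchange` becomes the square of `P`.
      P₂₁ : P ≡ per (M 0 0) (second ∷ U′) (first ∷ U′)
      P₂₁ = ≡.trans P₁₂ (≡.trans (per-transpose (M 0 0) (first ∷ U′) (second ∷ U′))
        (per-cong (λ x y → M 0 0 y x) (M 0 0) (λ x y → M-sym 0 0 y x)
          (second ∷ U′) (first ∷ U′)))

      P²≤ : P * P ≤ t * z + q * p
      P²≤ = begin
        P * P
          ≡⟨ cong₂ _*_ P₁₂ P₂₁ ⟩
        per (M 0 0) (first ∷ U′) (second ∷ U′) * per (M 0 0) (second ∷ U′) (first ∷ U′)
          ≤⟨ exchange (M 0 0) (length U′) U′ U′ first second second first refl ⟩
        per (M 0 0) (first ∷ second ∷ U′) (second ∷ first ∷ U′) * z + q * p
          ≡⟨ cong (λ s → s * z + q * p)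
              (per-↭ᶜ (M 0 0) (first ∷ second ∷ U′) (swap {xs = U′} second first ↭-refl)) ⟩
        t * z + q * p ∎

      -- `per-unfix` treats the head of the lists, so the mark concerned is brought to the front.
      swapped : ∀ α β → per (M α β) (second ∷ first ∷ U′) (second ∷ first ∷ U′) ≡
                        per (M α β) (first ∷ second ∷ U′) (first ∷ second ∷ U′)
      swapped α β = per-↭ (M α β) (swap {xs = U′} second first ↭-refl)
                                  (swap {xs = U′} second first ↭-refl)

      ≤p′ : z + p ≤ per (M 1 1) (second ∷ U′) (second ∷ U′)
      ≤p′ = begin
        z + p
          ≤⟨ +-monoˡ-≤ p (per-mono (M 0 0) (M 1 1) (M-mono z≤n z≤n) U′ U′) ⟩
        per (M 1 1) U′ U′ + p
          ≤⟨ per-unfix (M 0 0) (M 1 1) {second} {second} (M-mono z≤n z≤n) refl refl U′ U′ ⟩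
        per (M 1 1) (second ∷ U′) (second ∷ U′) ∎

      ≤t′ : q + t ≤ per (M 0 1) (second ∷ first ∷ U′) (second ∷ first ∷ U′)
      ≤t′ = begin
        q + t
          ≡⟨ cong (q +_) (swapped 0 0) ⟨
        q + per (M 0 0) (second ∷ first ∷ U′) (second ∷ first ∷ U′)
          ≤⟨ +-monoˡ-≤ _ (per-mono (M 0 0) (M 0 1) (M-mono z≤n z≤n) (first ∷ U′) (first ∷ U′)) ⟩
        per (M 0 1) (first ∷ U′) (first ∷ U′) +
        per (M 0 0) (second ∷ first ∷ U′) (second ∷ first ∷ U′)
          ≤⟨ per-unfix (M 0 0) (M 0 1) {second} {second} (M-mono z≤n z≤n) refl refl
              (first ∷ U′) (first ∷ U′) ⟩
        per (M 0 1) (second ∷ first ∷ U′) (second ∷ first ∷ U′) ∎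

      -- The diagonal entries are restored one at a time: the one at `second` in `≤p′` and `≤t′`,
      -- then the one at `first`.
      ≤D : z + p + (q + t) ≤ D
      ≤D = begin
        z + p + (q + t)
          ≤⟨ +-mono-≤ ≤p′ ≤t′ ⟩
        per (M 1 1) (second ∷ U′) (second ∷ U′) +
        per (M 0 1) (second ∷ first ∷ U′) (second ∷ first ∷ U′)
          ≡⟨ cong (per (M 1 1) (second ∷ U′) (second ∷ U′) +_) (swapped 0 1) ⟩
        per (M 1 1) (second ∷ U′) (second ∷ U′) +
        per (M 0 1) (first ∷ second ∷ U′) (first ∷ second ∷ U′)
          ≤⟨ per-unfix (M 0 1) (M 1 1) {first} {first} (M-mono z≤n ≤-refl) refl refl (second ∷ U′) (second ∷ U′) ⟩
        per (M 1 1) (first ∷ second ∷ U′) (first ∷ second ∷ U′)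
          ≡⟨ per-M₁₁ (first ∷ second ∷ U′) (first ∷ second ∷ U′) ⟩
        per A (a ∷ b ∷ map unmark U′) (a ∷ b ∷ map unmark U′)
          ≡⟨ cong (λ W → per A (a ∷ b ∷ W) (a ∷ b ∷ W)) (unmark-rest U) ⟩
        D ∎

  per-delete : ∀ s T → per A T T ≤ per A (s ∷ T) (s ∷ T)
  per-delete s T = begin
    per A T T               ≡⟨ *-identityˡ (per A T T) ⟨
    1 * per A T T           ≡⟨ cong (_* per A T T) (A-refl s) ⟨
    A s s * per A T T       ≤⟨ m≤m+n (A s s * per A T T) _ ⟩
    per A (s ∷ T) (s ∷ T)   ∎
    where open ≤-Reasoning

  -- Expansion along the row and column of v.

  module _ (A-idem : ∀ x y → A x y * A x y ≡ A x y) (v : V) (W : List V) where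

    private
      c k : ℕ
      c = per A W W
      k = ∑ W (λ x _ → A v x)

    -- `per A W (v ∷ T)` is the minor left after v is sent to `s`. Column v is then matched with
    -- `s`, closing a 2-cycle of weight at most `c`, or with some `r` in `T`, where the remaining
    -- minor is at most half of `c`. After doubling, the coefficients add up to 2 `A v s` plus the
    -- sum over `T`, which is `A v s + k`.
    through-edge : ∀ s T → W ↭ s ∷ T → 2 * per A W (v ∷ T) ≤ (A v s + k) * c
    through-edge s T W↭sT = begin
      2 * per A W (v ∷ T)
        ≡⟨ cong (2 *_) (≡.trans (per-↭ʳ A (v ∷ T) W↭sT) (per-expandᶜ A (s ∷ T) v T)) ⟩
      2 * (A s v * per A T T + ∑ T (λ r U → A r v * per A (s ∷ U) T))
        ≡⟨ *-distribˡ-+ 2 (A s v * per A T T) _ ⟩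
      2 * (A s v * per A T T) + 2 * ∑ T (λ r U → A r v * per A (s ∷ U) T)
        ≤⟨ +-mono-≤ loops paths ⟩
      2 * (A v s * c) + ∑ T (λ r _ → A v r) * c
        ≡⟨ lemma (A v s) c (∑ T (λ r _ → A v r)) ⟩
      (A v s + (A v s + ∑ T (λ r _ → A v r))) * c
        ≡⟨ cong (λ m → (A v s + m) * c) (∑-↭ (λ _ _ → refl) W↭sT) ⟨
      (A v s + k) * c ∎
      where
      open ≤-Reasoning
      lemma : ∀ a c t → 2 * (a * c) + t * c ≡ (a + (a + t)) * c
      lemma = solve-∀
      lemma′ : ∀ a p → 2 * (a * p) ≡ a * (2 * p)
      lemma′ = solve-∀

      loops : 2 * (A s v * per A T T) ≤ 2 * (A v s * c)
      loops = *-monoʳ-≤ 2 (*-mono-≤ (≤-reflexive (A-sym s v))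
        (≤-trans (per-delete s T) (≤-reflexive (sym (per-↭ A W↭sT W↭sT)))))

      path : ∀ r U → T ↭ r ∷ U → 2 * (A r v * per A (s ∷ U) T) ≤ A v r * c
      path r U T↭rU = begin
        2 * (A r v * per A (s ∷ U) T)
          ≡⟨ cong₂ (λ m n → 2 * (m * n)) (A-sym r v) (per-↭ᶜ A (s ∷ U) T↭rU) ⟩
        2 * (A v r * per A (s ∷ U) (r ∷ U))
          ≡⟨ lemma′ (A v r) (per A (s ∷ U) (r ∷ U)) ⟩
        A v r * (2 * per A (s ∷ U) (r ∷ U))
          ≤⟨ *-monoʳ-≤ (A v r) (2*offdiag≤per s r U) ⟩
        A v r * per A (s ∷ r ∷ U) (s ∷ r ∷ U)
          ≡⟨ cong (A v r *_) (per-↭ A W↭ W↭) ⟨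
        A v r * c ∎
        where
        W↭ : W ↭ s ∷ r ∷ U
        W↭ = trans W↭sT (prep s T↭rU)

      paths : 2 * ∑ T (λ r U → A r v * per A (s ∷ U) T) ≤ ∑ T (λ r _ → A v r) * c
      paths = begin
        2 * ∑ T (λ r U → A r v * per A (s ∷ U) T)   ≡⟨ ∑-*ˡ T _ 2 ⟩
        ∑ T (λ r U → 2 * (A r v * per A (s ∷ U) T)) ≤⟨ ∑-mono T path ⟩
        ∑ T (λ r _ → A v r * c)                     ≡⟨ ∑-*ʳ T _ c ⟨
        ∑ T (λ r _ → A v r) * c                     ∎

    -- The loop at v gives `c`, and each `s` is bounded by `through-edge`. An idempotent entry
    -- absorbs its square, so the sum of `A v s * (A v s + k)` over `W` is k + k².
    2*per≤ : 2 * per A (v ∷ W) (v ∷ W) ≤ (2 + (k + k * k)) * c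
    2*per≤ = begin
      2 * (A v v * c + S)
        ≡⟨ cong (λ m → 2 * (m * c + S)) (A-refl v) ⟩
      2 * (1 * c + S)
        ≡⟨ lemma₁ c S ⟩
      2 * c + 2 * S
        ≡⟨ cong (2 * c +_) (∑-*ˡ W _ 2) ⟩
      2 * c + ∑ W (λ s T → 2 * (A v s * per A W (v ∷ T)))
        ≤⟨ +-monoʳ-≤ (2 * c) (∑-mono W step) ⟩
      2 * c + ∑ W (λ s _ → (A v s + A v s * k) * c)
        ≡⟨ cong (2 * c +_) (∑-*ʳ W _ c) ⟨
      2 * c + ∑ W (λ s _ → A v s + A v s * k) * c
        ≡⟨ cong (λ m → 2 * c + m * c)
            (≡.trans (∑-+ W _ _) (cong (k +_) (sym (∑-*ʳ W _ k)))) ⟩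
      2 * c + (k + k * k) * c
        ≡⟨ *-distribʳ-+ c 2 (k + k * k) ⟨
      (2 + (k + k * k)) * c ∎
      where
      open ≤-Reasoning
      S : ℕ
      S = ∑ W (λ s T → A v s * per A W (v ∷ T))
      lemma₁ : ∀ c S → 2 * (1 * c + S) ≡ 2 * c + 2 * S
      lemma₁ = solve-∀
      lemma₂ : ∀ a p → 2 * (a * p) ≡ a * (2 * p)
      lemma₂ = solve-∀
      lemma₃ : ∀ a k c → a * ((a + k) * c) ≡ (a * a + a * k) * c
      lemma₃ = solve-∀
      step : ∀ s T → W ↭ s ∷ T →
             2 * (A v s * per A W (v ∷ T)) ≤ (A v s + A v s * k) * c
      step s T W↭sT = begin
        2 * (A v s * per A W (v ∷ T))   ≡⟨ lemma₂ (A v s) (per A W (v ∷ T)) ⟩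
        A v s * (2 * per A W (v ∷ T))   ≤⟨ *-monoʳ-≤ (A v s) (through-edge s T W↭sT) ⟩
        A v s * ((A v s + k) * c)       ≡⟨ lemma₃ (A v s) k c ⟩
        (A v s * A v s + A v s * k) * c ≡⟨ cong (λ m → (m + A v s * k) * c) (A-idem v s) ⟩
        (A v s + A v s * k) * c         ∎

-- Counting cycle covers by a permanent.

⟦_⟧ : {P : Set} → Dec P → ℕ
⟦ P? ⟧ = if does P? then 1 else 0

⟦⟧-idem : {P : Set} (P? : Dec P) → ⟦ P? ⟧ * ⟦ P? ⟧ ≡ ⟦ P? ⟧
⟦⟧-idem P? with does P?
... | true  = refl
... | false = refl

tabulate-↭ : ∀ (c : Fin (suc n) → X) v → tabulate c ↭ c v ∷ tabulate (c ∘ punchIn v)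
tabulate-↭ {n = n}     c zero    = ↭-refl
tabulate-↭ {n = suc n} c (suc v) =
  trans (prep (c zero) (tabulate-↭ (c ∘ suc) v)) (swap (c zero) (c (suc v)) ↭-refl)

∑-tabulate : ∀ (c : Fin (suc n) → X) f →
             ∑ (tabulate c) f ≡ sum (tabulate λ j → f (c j) (tabulate (c ∘ punchIn j)))
∑-tabulate {n = zero}  c f = refl
∑-tabulate {n = suc n} c f = cong (f (c zero) (tabulate (c ∘ suc)) +_)
  (∑-tabulate (c ∘ suc) (λ y ys → f y (c zero ∷ ys)))

module _ {P : Y → Set} (P? : Unary.Decidable P) where

  length-filter-∑ : ∀ xs → length (filter P? xs) ≡ ∑ xs (λ x _ → ⟦ P? x ⟧)
  length-filter-∑ []       = refl
  length-filter-∑ (x ∷ xs) with does (P? x)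
  ... | true  = cong suc (length-filter-∑ xs)
  ... | false = length-filter-∑ xs

  length-filter-map : ∀ (f : X → Y) xs →
                      length (filter P? (map f xs)) ≡ length (filter (P? ∘ f) xs)
  length-filter-map f []       = refl
  length-filter-map f (x ∷ xs) with does (P? (f x))
  ... | true  = cong suc (length-filter-map f xs)
  ... | false = length-filter-map f xs

  length-filter-concatMap : ∀ (f : X → List Y) xs →
    length (filter P? (concatMap f xs)) ≡ sum (map (λ x → length (filter P? (f x))) xs)
  length-filter-concatMap f []       = refl
  length-filter-concatMap f (x ∷ xs) = begin
    length (filter P? (f x ++ concatMap f xs))
      ≡⟨ cong length (filter-++ P? (f x) (concatMap f xs)) ⟩
    length (filter P? (f x) ++ filter P? (concatMap f xs))
      ≡⟨ length-++ (filter P? (f x)) ⟩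
    length (filter P? (f x)) + length (filter P? (concatMap f xs))
      ≡⟨ cong (length (filter P? (f x)) +_) (length-filter-concatMap f xs) ⟩
    length (filter P? (f x)) + sum (map (λ y → length (filter P? (f y))) xs) ∎
    where open ≡-Reasoning

-- Stated for arbitrary relations because crossing out row `zero` and a different column `j` need
-- not leave a symmetric or reflexive relation. For the edges of a graph it unfolds to
-- `IsCycleCover`.
Supports : (Fin n → Fin n → Set) → Permutation′ n → Set
Supports E π = ∀ u → E u (π ⟨$⟩ʳ u)

supports? : {E : Fin n → Fin n → Set} → Decidable E → Unary.Decidable (Supports E)
supports? E? π = all? (λ u → E? u (π ⟨$⟩ʳ u))

-- Every `insert zero j π` sends `zero` to `j`, so the entry there rejects the whole block or
-- imposes nothing; the other rows see `π` through `punchIn j`.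
supports-insert : {E : Fin (suc n) → Fin (suc n) → Set} (E? : Decidable E) →
  ∀ j (πs : List (Permutation′ n)) →
  length (filter (supports? E?) (map (insert zero j) πs)) ≡
  ⟦ E? zero j ⟧ * length (filter (supports? λ u k → E? (suc u) (punchIn j k)) πs)
supports-insert {E = E} E? j πs =
  ≡.trans (length-filter-map (supports? E?) (insert zero j) πs) (block (E? zero j))
  where
  block : (e? : Dec (E zero j)) → length (filter (supports? E? ∘ insert zero j) πs) ≡
          ⟦ e? ⟧ * length (filter (supports? λ u k → E? (suc u) (punchIn j k)) πs)
  block (no ¬e) = cong length
    (filter-none (supports? E? ∘ insert zero j) (All.universal (λ π s → ¬e (s zero)) πs))
  block (yes e) = ≡.trans
    (cong length (filter-≐ (supports? E? ∘ insert zero j)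
      (supports? λ u k → E? (suc u) (punchIn j k))
      ((λ {π} → to {π}) , λ {π} → from {π}) πs))
    (sym (*-identityˡ _))
    where
    to : ∀ {π} → Supports E (insert zero j π) →
         Supports (λ u k → E (suc u) (punchIn j k)) π
    to {π} s u = subst (E (suc u)) (insert-punchIn zero j π u) (s (suc u))
    from : ∀ {π} → Supports (λ u k → E (suc u) (punchIn j k)) π →
           Supports E (insert zero j π)
    from {π} s zero    = e
    from {π} s (suc u) = subst (E (suc u)) (sym (insert-punchIn zero j π u)) (s u)

-- The blocks of `permutations` are the terms of the expansion along row `zero`. The labellings `r`
-- and `c` are independent since the recursion deletes row `zero` but column `j`, while `A` stays
-- the same.
count≡per : {E : Fin n → Fin n → Set} (E? : Decidable E) (A : X → Y → ℕ)
  (r : Fin n → X) (c : Fin n → Y) → (∀ i j → ⟦ E? i j ⟧ ≡ A (r i) (c j)) →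
  length (filter (supports? E?) (permutations n)) ≡ per A (tabulate r) (tabulate c)
count≡per {n = zero}  E? A r c eq = refl
count≡per {n = suc n} E? A r c eq = begin
  length (filter (supports? E?)
    (concatMap (λ j → map (insert zero j) (permutations n)) (allFin (suc n))))
    ≡⟨ length-filter-concatMap (supports? E?)
        (λ j → map (insert zero j) (permutations n)) (allFin (suc n)) ⟩
  sum (map (λ j → length (filter (supports? E?) (map (insert zero j) (permutations n))))
           (allFin (suc n)))
    ≡⟨ cong sum (map-tabulate {n = suc n} id _) ⟩
  sum (tabulate λ j → length (filter (supports? E?) (map (insert zero j) (permutations n))))
    ≡⟨ cong sum (tabulate-cong λ j → ≡.trans (supports-insert E? j (permutations n))
        (cong₂ _*_ (eq zero j)
          (count≡per (λ u k → E? (suc u) (punchIn j k)) A (r ∘ suc) (c ∘ punchIn j)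
            (λ i k → eq (suc i) (punchIn j k))))) ⟩
  sum (tabulate λ j →
    A (r zero) (c j) * per A (tabulate (r ∘ suc)) (tabulate (c ∘ punchIn j)))
    ≡⟨ ∑-tabulate c (λ y ys → A (r zero) y * per A (tabulate (r ∘ suc)) ys) ⟨
  per A (tabulate r) (tabulate c) ∎
  where open ≡-Reasoning

-- From natural numbers to the rational bound.

open import Data.Integer.Base as ℤ using (+_; +≤+)
import Data.Integer.Properties as ℤ
open import Data.Rational.Base as ℚ using (1ℚ; _/_; toℚᵘ)
import Data.Rational.Properties as ℚ
open import Data.Rational.Unnormalised.Base as ℚᵘ using (mkℚᵘ; *≤*)
import Data.Rational.Unnormalised.Properties as ℚᵘ

-- Unnormalised rationals are compared by cross-multiplication without reducing fractions, which
-- turns the goal into the hypothesis with d = k + 1.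
/≤1+[d²∸d]/2 : ∀ m n k .{{_ : NonZero n}} → 2 * m ≤ (2 + (k + k * k)) * n →
  let d = + suc k in + m / n ℚ.≤ 1ℚ ℚ.+ (d ℤ.* d ℤ.- d) / 2
/≤1+[d²∸d]/2 m n@(suc n-1) k 2m≤ = ℚ.toℚᵘ-cancel-≤ (begin
  -- `mkℚᵘ` stores the denominator minus one, so `mkℚᵘ d²-d 1` has denominator 2.
  toℚᵘ (+ m / n)                           ≃⟨ ℚ.toℚᵘ-fromℚᵘ (mkℚᵘ (+ m) n-1) ⟩
  mkℚᵘ (+ m) n-1                           ≤⟨ *≤* cross ⟩
  ℚᵘ.1ℚᵘ ℚᵘ.+ mkℚᵘ d²-d 1                  ≃⟨ ℚᵘ.+-congʳ ℚᵘ.1ℚᵘ (ℚ.toℚᵘ-fromℚᵘ (mkℚᵘ d²-d 1)) ⟨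
  toℚᵘ 1ℚ ℚᵘ.+ toℚᵘ (d²-d / 2)             ≃⟨ ℚ.toℚᵘ-homo-+ 1ℚ (d²-d / 2) ⟨
  toℚᵘ (1ℚ ℚ.+ d²-d / 2)                   ∎)
  where
  open ℚᵘ.≤-Reasoning
  d²-d : ℤ.ℤ
  d²-d = + suc k ℤ.* + suc k ℤ.- + suc k

  d²-d≡ : d²-d ≡ + (k + k * k)
  d²-d≡ = ≡.trans (ℤ.[+m]-[+n]≡m⊖n (suc k * suc k) (suc k))
    (≡.trans (ℤ.⊖-≥ (m≤m+n (suc k) (k * suc k)))
      (cong +_ (≡.trans (m+n∸m≡n (suc k) (k * suc k)) (*-suc k k))))

  cross : + m ℤ.* + 2 ℤ.≤ (+ 1 ℤ.* + 2 ℤ.+ d²-d ℤ.* + 1) ℤ.* + n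
  cross = subst (λ i → + m ℤ.* + 2 ℤ.≤ (+ 1 ℤ.* + 2 ℤ.+ i ℤ.* + 1) ℤ.* + n) (sym d²-d≡)
    (subst (λ i → + m ℤ.* + 2 ℤ.≤ (+ 2 ℤ.+ i) ℤ.* + n) (sym (ℤ.*-identityʳ (+ (k + k * k))))
      (ℤ.≤-trans (ℤ.≤-reflexive (≡.trans (sym (ℤ.pos-* m 2)) (cong +_ (*-comm m 2))))
        (ℤ.≤-trans (+≤+ 2m≤) (ℤ.≤-reflexive (ℤ.pos-* (2 + (k + k * k)) n)))))

theorem2p1 : ∀ {n : ℕ} (G : Graph (suc n)) (v : Fin (suc n)) →
    let d = + (degree G v) in
    R G v ℚ.≤ 1ℚ ℚ.+ (d ℤ.* d ℤ.- d) / 2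
theorem2p1 {n} G v = subst
  (λ d → R G v ℚ.≤ 1ℚ ℚ.+ (+ d ℤ.* + d ℤ.- + d) / 2) (sym degree≡)
  (/≤1+[d²∸d]/2 (C G) (C (G ─ v)) k {{C-nonZero (G ─ v)}}
    (subst (λ c → 2 * C G ≤ (2 + (k + k * k)) * c) (sym C[G-v]≡)
      (subst (λ c → 2 * c ≤ (2 + (k + k * k)) * per A W W) (sym C[G]≡)
        (2*per≤ A A-sym A-refl (λ x y → ⟦⟧-idem (edge? x y)) v W))))
  where
  open Graph G
  A : Fin (suc n) → Fin (suc n) → ℕ
  A x y = ⟦ edge? x y ⟧

  W : List (Fin (suc n))
  W = tabulate (punchIn v)

  k : ℕ
  k = ∑ W (λ x _ → A v x)

  A-sym : ∀ x y → A x y ≡ A y x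
  A-sym x y = cong (λ b → if b then 1 else 0)
    (does-⇔ (mk⇔ symmetric symmetric) (edge? x y) (edge? y x))

  A-refl : ∀ x → A x x ≡ 1
  A-refl x = cong (λ b → if b then 1 else 0) (dec-true (edge? x x) loop)

  -- With v moved to the front, its loop supplies the 1 and `k` counts the other neighbours.
  degree≡ : degree G v ≡ suc k
  degree≡ = ≡.trans (length-filter-∑ (edge? v) (allFin (suc n)))
    (≡.trans (∑-↭ (λ _ _ → refl) (tabulate-↭ id v)) (cong (_+ k) (A-refl v)))

  C[G]≡ : C G ≡ per A (v ∷ W) (v ∷ W)
  C[G]≡ = ≡.trans (count≡per edge? A id id (λ _ _ → refl))
    (per-↭ A (tabulate-↭ id v) (tabulate-↭ id v))

  C[G-v]≡ : C (G ─ v) ≡ per A W W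
  C[G-v]≡ = count≡per (Graph.edge? (G ─ v)) A (punchIn v) (punchIn v) (λ _ _ → refl)
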